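{- Let $k > \ell \geq 1$ be integers and let $e_1,\ldots,e_t$ be positive integers. Then \[ R_<\big(P_{e_1}^{k,\ell},\ldots,P_{e_t}^{k,\ell}\big)=(k-\ell)\,\big|Q_{i(k,\ell)}(e_1,\dots,e_t)\big|+\ell-(k-\ell)\big(i(k,\ell)-2\big). \]
   Context: An ordered $k$-uniform hypergraph is a $k$-uniform hypergraph with a totally ordered vertex set. An ordered hypergraph $G$ is contained in an ordered hypergraph $H$ if there is an injective order-preserving map $V(G)\to V(H)$ sending every edge of $G$ to an edge of $H$. $K_N^k$ is the complete $k$-uniform hypergraph on $[N]=\{1,\dots,N\}$ with the natural order. For ordered $k$-uniform hypergraphs $G_1,\dots,G_t$, the ordered Ramsey number $R_<(G_1,\dots,G_t)$ is the least $N$ such that for every coloring $c:E(K_N^k)\to[t]$ there is a color $j$ such that the hypergraph formed by the edges of color $j$ contains $G_j$. For integers $k>\ell\ge 0$ and $e\ge1$, the path $P_e^{k,\ell}$ is the ordered $k$-uniform hypergraph on vertex set $[e(k-\ell)+\ell]$ with edges $A_r=\{(r-1)(k-\ell)+1,\dots,(r-1)(k-\ell)+k\}$ for $r=1,\dots,e$. For $k>\ell\ge1$, $i(k,\ell)$ is the unique integer $m\ge2$ with $\frac{m-2}{m-1}<\frac{\ell}{k}\le\frac{m-1}{m}$. For a poset $P$, a down-set is a subset $S\subseteq P$ such that $y\in S$ and $x\le y$ imply $x\in S$; $J(P)$ denotes the poset of all down-sets of $P$ ordered by inclusion. The poset $Q_1(e_1,\dots,e_t)$ is the disjoint union of $t$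 chains of sizes $e_1-1,\dots,e_t-1$ (elements in different chains incomparable), and $Q_{m+1}(e_1,\dots,e_t)=J(Q_m(e_1,\dots,e_t))$ for $m\ge1$. -}

module Defs where

open import Data.Nat using (ℕ; zero; suc; _+_; _*_; _∸_; _≤_; _<_; _≤ᵇ_)
open import Data.Bool using (Bool; true; false; _∧_; _∨_; not; if_then_else_)
open import Data.Fin using (Fin; toℕ; splitAt) renaming (_<_ to _<ᶠ_)
open import Data.Vec using (Vec; []; _∷_; lookup; map)
open import Data.List using (List; []; _∷_; _++_; length; filterᵇ; allFin; concatMap)
import Data.List as L
open import Data.Sum using (inj₁; inj₂)
open import Data.Product using (Σ; ∃; ∃-syntax; _×_; _,_)
open import Relation.Binary.PropositionalEquality using (_≡_)
open import Relation.Nullary using (¬_)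

-- An ordered k-uniform hypergraph on the vertex set Fin n (natural order).
-- An edge {a₁ < … < a_k} is represented by the vector (a₁,…,a_k);
-- IsEdge picks out which (increasing) vectors are edges.
record OrdHypergraph (k : ℕ) : Set₁ where
  field
    n      : ℕ
    IsEdge : Vec (Fin n) k → Set
open OrdHypergraph public

-- A t-coloring of the edges of K_N^k.  An edge of K_N^k is a k-subset of
-- [N], i.e. a strictly increasing vector in Vec (Fin N) k; the values of a
-- coloring on non-increasing vectors are irrelevant (never used below).
Coloring : ℕ → ℕ → ℕ → Set
Coloring N k t = Vec (Fin N) k → Fin t

StrictlyIncreasing : ∀ {n N} → (Fin n → Fin N) → Set
StrictlyIncreasing f = ∀ {a b} → a <ᶠ b → f a <ᶠ f b

ContainedInColor : ∀ {k N t} → OrdHypergraph k → Coloring N k t → Fin t → Set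
ContainedInColor G c j =
  Σ (Fin (n G) → Fin _) λ f →
    StrictlyIncreasing f × (∀ v → IsEdge G v → c (map f v) ≡ j)

RamseyProperty : (k t : ℕ) → (Fin t → OrdHypergraph k) → ℕ → Set
RamseyProperty k t G N = (c : Coloring N k t) → ∃[ j ] ContainedInColor (G j) c j

IsOrderedRamseyNumber : (k t : ℕ) → (Fin t → OrdHypergraph k) → ℕ → Set
IsOrderedRamseyNumber k t G R =
  RamseyProperty k t G R × (∀ N → N < R → ¬ RamseyProperty k t G N)

Path : (k ℓ e : ℕ) → OrdHypergraph k
Path k ℓ e = record
  { n      = e * (k ∸ ℓ) + ℓ
  ; IsEdge = λ v → ∃[ r ] (r < e × (∀ s → toℕ (lookup v s) ≡ r * (k ∸ ℓ) + toℕ s))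
  }

-- i(k,ℓ): m ≥ 2 with (m-2)/(m-1) < ℓ/k ≤ (m-1)/m   (cross-multiplied)

IsI : (k ℓ m : ℕ) → Set
IsI k ℓ m = 2 ≤ m × ((m ∸ 2) * k < ℓ * (m ∸ 1)) × (ℓ * m ≤ (m ∸ 1) * k)

record FinPoset : Set where
  field
    size : ℕ
    leq  : Fin size → Fin size → Bool
open FinPoset public

chain : ℕ → FinPoset
chain c = record { size = c ; leq = λ i j → toℕ i ≤ᵇ toℕ j }

emptyPoset : FinPoset
emptyPoset = record { size = 0 ; leq = λ () }

_⊕_ : FinPoset → FinPoset → FinPoset
P ⊕ Q = record { size = size P + size Q ; leq = le }
  where
  le : Fin (size P + size Q) → Fin (size P + size Q) → Bool
  le a b with splitAt (size P) a | splitAt (size P) b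
  ... | inj₁ x | inj₁ y = leq P x y
  ... | inj₂ x | inj₂ y = leq Q x y
  ... | _      | _      = false

all : ∀ {A : Set} → (A → Bool) → List A → Bool
all p []       = true
all p (x ∷ xs) = p x ∧ all p xs

allSubsets : (n : ℕ) → List (Vec Bool n)
allSubsets zero    = [] ∷ []
allSubsets (suc n) = concatMap (λ S → (false ∷ S) ∷ (true ∷ S) ∷ []) (allSubsets n)

isDownSet : (P : FinPoset) → Vec Bool (size P) → Bool
isDownSet P S =
  all (λ x → all (λ y → not (leq P x y ∧ lookup S y) ∨ lookup S x) (allFin (size P)))
      (allFin (size P))

_⊆ᵇ_ : ∀ {n} → Vec Bool n → Vec Bool n → Bool
_⊆ᵇ_ {n} S T = all (λ x → not (lookup S x) ∨ lookup T x) (allFin n)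

downSets : (P : FinPoset) → List (Vec Bool (size P))
downSets P = filterᵇ (isDownSet P) (allSubsets (size P))

J : FinPoset → FinPoset
J P = record
  { size = length (downSets P)
  ; leq  = λ i j → L.lookup (downSets P) i ⊆ᵇ L.lookup (downSets P) j }

Q₁ : (t : ℕ) → (Fin t → ℕ) → FinPoset
Q₁ zero    e = emptyPoset
Q₁ (suc t) e = chain (e Fin.zero ∸ 1) ⊕ Q₁ t (λ j → e (Fin.suc j))
  where import Data.Fin as Fin

-- Q m t e = Q_m(e_1,…,e_t) for m ≥ 1 (Q 0 is set to Q_1 by convention; unused)
Q : ℕ → (t : ℕ) → (Fin t → ℕ) → FinPoset
Q zero          t e = Q₁ t e
Q (suc zero)    t e = Q₁ t e
Q (suc (suc m)) t e = J (Q (suc m) t e)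

{-# OPTIONS --safe #-}
module Submission where

-- Put d = k − ℓ and m = i(k,ℓ), so that k = (m − 1) d + s + 1 with 0 ≤ s < d and the claimed value
-- is d |Q_m| + s + 1.  Cutting [N] into blocks of d vertices (and a last one of s + 1) turns
-- m-tuples of blocks into k-sets and back, consecutive tuples corresponding to consecutive
-- edges of P^{k,ℓ}; this reduces the claim to tight paths in m-uniform hypergraphs, where the
-- value is |Q_m| + 1.
--
-- For tight paths, consider labellings f of increasing a-tuples by elements of a poset P with
-- f(x₂,…,x_{a+1}) ≰ f(x₁,…,x_a).  Colourings without long monochromatic tight paths amount to
-- such labellings of m-tuples by Q_1: the label is the colour with the position of the edge in
-- a longest path.  A labelling of (a+1)-tuples by P yields one of a-tuples by J(P) (the
-- down-set generated by all f(x, x₁,…,x_a) with x < x₁), and conversely a labelling g of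
-- a-tuples by J(P) yields one of (a+1)-tuples by P (any element of
-- g(x₂,…,x_{a+1}) ∖ g(x₁,…,x_a)).  So everything is decided by 1-tuples labelled by Q_m:
-- their labels are distinct, and a linear extension of Q_m attains |Q_m| vertices.

open import Defs
open import Data.Nat using (ℕ; zero; suc; _+_; _*_; _∸_; _≤_; _<_; z≤n; s≤s; s≤s⁻¹;
  NonZero; >-nonZero; _<?_)
open import Data.Nat.Properties hiding (_≟_; _≤?_; _<?_)
open import Data.Nat.DivMod
open import Data.Nat.Divisibility using (divides-refl)
open import Data.Bool using (Bool; true; false; T; _∧_; _∨_; not)
open import Data.Bool.Properties using (T?; T-≡)
open import Data.Fin as Fin using (Fin; zero; suc; toℕ; fromℕ<; opposite; splitAt; _↑ˡ_; _↑ʳ_)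
  renaming (_<_ to _<ᶠ_)
import Data.Fin.Properties as Finₚ
open import Data.Vec as Vec using (Vec; []; _∷_; lookup; tabulate; head; tail; init)
import Data.Vec.Properties as Vecₚ
open import Data.Vec.Relation.Unary.Linked as Linked using (Linked; []; [-]; _∷_; linked?)
open import Data.List as List using (List; []; _∷_; allFin)
open import Data.List.Membership.Propositional using (_∈_)
open import Data.List.Membership.Propositional.Properties using (∈-allFin; ∈-filter⁺; ∈-lookup; ∈-concatMap⁺)
open import Data.List.Relation.Unary.Any as Any using (here; there)
import Data.List.Relation.Unary.Any.Properties as Anyₚ
open import Data.List.Relation.Unary.All as All using ([]; _∷_)
import Data.List.Relation.Unary.All.Properties as Allₚ
open import Data.List.Relation.Unary.AllPairs as AllPairs using (AllPairs; []; _∷_)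
import Data.List.Relation.Unary.AllPairs.Properties as AllPairsₚ
open import Data.Product using (Σ; ∃; ∃-syntax; _×_; _,_; proj₁; proj₂)
open import Data.Sum using (inj₁; inj₂)
open import Data.Unit using (⊤; tt)
open import Data.Empty using (⊥-elim-irr)
open import Function using (_∘_; id; _⇔_; mk⇔; Equivalence)
open import Relation.Binary.PropositionalEquality hiding (J)
open import Relation.Nullary using (¬_; Dec; yes; no; contradiction; recompute)
open import Relation.Nullary.Decidable using 
  (¬?; map′; _×-dec_; ⌊_⌋; toWitness; fromWitness; decidable-stable)
open import Relation.Unary using (Decidable)

open Equivalence using (to; from)

private
  variable
    A : Set
    N a : ℕ

-- Boolean tests and the propositions they decide.

T-all⁻ : ∀ (p : A → Bool) {xs x} → T (all p xs) → x ∈ xs → T (p x)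
T-all⁻ p {y ∷ _} h _ with p y in eq
T-all⁻ p h (here refl) | true = from T-≡ eq
T-all⁻ p h (there x∈)  | true = T-all⁻ p h x∈

T-all⁺ : ∀ (p : A → Bool) xs → (∀ x → T (p x)) → T (all p xs)
T-all⁺ p []       h = tt
T-all⁺ p (x ∷ xs) h with p x | h x
... | true | _ = T-all⁺ p xs h

T-all-allFin : (p : Fin N → Bool) → T (all p (allFin N)) ⇔ (∀ x → T (p x))
T-all-allFin p = mk⇔ (λ h x → T-all⁻ p h (∈-allFin x)) (T-all⁺ p (allFin _))

T-⇒ : ∀ {x y} → T (not x ∨ y) ⇔ (T x → T y)
T-⇒ {false} = mk⇔ (λ _ ()) _
T-⇒ {true}  = mk⇔ (λ h _ → h) (λ h → h tt)

T-⇒₂ : ∀ {x y z} → T (not (x ∧ y) ∨ z) ⇔ (T x → T y → T z)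
T-⇒₂ {false} = mk⇔ (λ _ ()) _
T-⇒₂ {true}  = mk⇔ (λ h _ → to T-⇒ h) (λ h → from T-⇒ (h tt))

Le : (P : FinPoset) → Fin (size P) → Fin (size P) → Set
Le P x y = T (leq P x y)

record IsPreorderᵇ (P : FinPoset) : Set where
  field
    reflexive  : ∀ x → Le P x x
    transitive : ∀ {x y z} → Le P x y → Le P y z → Le P x z
open IsPreorderᵇ

-- The poset of down-sets

_⊆ᵛ_ : Vec Bool N → Vec Bool N → Set
S ⊆ᵛ U = ∀ x → T (lookup S x) → T (lookup U x)

T-⊆ᵇ : (S U : Vec Bool N) → T (S ⊆ᵇ U) ⇔ S ⊆ᵛ U
T-⊆ᵇ _ _ = mk⇔
  (λ h x → to T-⇒ (to (T-all-allFin _) h x))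
  (λ h → from (T-all-allFin _) (λ x → from T-⇒ (h x)))

IsDown : (P : FinPoset) → Vec Bool (size P) → Set
IsDown P S = ∀ x y → Le P x y → T (lookup S y) → T (lookup S x)

T-isDownSet : ∀ P S → T (isDownSet P S) ⇔ IsDown P S
T-isDownSet P S = mk⇔
  (λ h x y → to T-⇒₂ (to (T-all-allFin _) (to (T-all-allFin _) h x) y))
  (λ h → from (T-all-allFin _) (λ x → from (T-all-allFin _) (λ y → from T-⇒₂ (h x y))))

∈-allSubsets : (S : Vec Bool N) → S ∈ allSubsets N
∈-allSubsets []      = here refl
∈-allSubsets (s ∷ S) = ∈-concatMap⁺ _ (Any.map (λ { refl → extend s }) (∈-allSubsets S))
  where
  extend : ∀ s → s ∷ S ∈ (false ∷ S) ∷ (true ∷ S) ∷ []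
  extend false = here refl
  extend true  = there (here refl)

-- The last coordinate is the most significant one in this enumeration, so at the last
-- coordinate where an earlier and a later set differ, the later one has true.
allSubsets-ordered : ∀ N → AllPairs (λ S U → ¬ U ⊆ᵛ S) (allSubsets N)
allSubsets-ordered zero    = [] ∷ []
allSubsets-ordered (suc N) = AllPairsₚ.concat⁺
  (Allₚ.map⁺ (All.universal (λ _ → ((λ h → h zero tt) ∷ []) ∷ [] ∷ []) _))
  (AllPairsₚ.map⁺ (AllPairs.map
    (λ S⊉U → (restrict S⊉U ∷ restrict S⊉U ∷ []) ∷ (restrict S⊉U ∷ restrict S⊉U ∷ []) ∷ [])
    (allSubsets-ordered N)))
  where
  restrict : ∀ {s u} {S U : Vec Bool N} → ¬ U ⊆ᵛ S → ¬ (u ∷ U) ⊆ᵛ (s ∷ S)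
  restrict S⊉U h = S⊉U (h ∘ suc)

AllPairs-lookup : ∀ {R : A → A → Set} {xs} → AllPairs R xs → ∀ {i j} → i <ᶠ j →
  R (List.lookup xs i) (List.lookup xs j)
AllPairs-lookup (Rx ∷ _) {zero}  {suc j} _         = All.lookup Rx (∈-lookup j)
AllPairs-lookup (_ ∷ Rs) {suc i} {suc j} (s≤s i<j) = AllPairs-lookup Rs i<j

module _ (P : FinPoset) where

  members : Fin (size (J P)) → Vec Bool (size P)
  members = List.lookup (downSets P)

  infix 4 _∈ᴶ_
  _∈ᴶ_ : Fin (size P) → Fin (size (J P)) → Set
  x ∈ᴶ D = T (lookup (members D) x)

  Le-J : ∀ D E → Le (J P) D E ⇔ (∀ x → x ∈ᴶ D → x ∈ᴶ E)
  Le-J D E = T-⊆ᵇ (members D) (members E)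

  ∈ᴶ-down : ∀ D → IsDown P (members D)
  ∈ᴶ-down D = to (T-isDownSet P (members D))
    (All.lookup (Allₚ.all-filter (T? ∘ isDownSet P) (allSubsets (size P))) (∈-lookup D))

  fromDown : (S : Vec Bool (size P)) → IsDown P S → ∃[ D ] S ≡ members D
  fromDown S down = Any.index S∈ , Anyₚ.lookup-index S∈
    where
    S∈ : S ∈ downSets P
    S∈ = ∈-filter⁺ (T? ∘ isDownSet P) (∈-allSubsets S) (from (T-isDownSet P S) down)

  -- Filtering preserves the order of the enumeration, so the numbering of the down-sets is itself a
  -- linear extension of inclusion. This is what lets 1-tuples attain the bound.
  J-linearExtension : ∀ {D E} → D <ᶠ E → ¬ Le (J P) E D
  J-linearExtension {D} {E} D<E = AllPairs-lookup
    (AllPairsₚ.filter⁺ (T? ∘ isDownSet P) (allSubsets-ordered (size P))) D<E ∘ to (Le-J E D)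

  J-isPreorder : IsPreorderᵇ (J P)
  J-isPreorder .reflexive D = from (Le-J D D) (λ _ → id)
  J-isPreorder .transitive {D} {E} {F} D⊆E E⊆F =
    from (Le-J D F) (λ x → to (Le-J E F) E⊆F x ∘ to (Le-J D E) D⊆E x)

  -- The full set is a down-set; it supplies the default vertex in the lower bound.
  J-nonempty : Fin (size (J P))
  J-nonempty = proj₁ (fromDown (tabulate (λ _ → true)) λ x _ _ _ →
    from T-≡ (Vecₚ.lookup∘tabulate _ x))

-- The disjoint union of chains

chainOf : ∀ t e → Fin (size (Q₁ t e)) → Fin t
chainOf (suc t) e x with splitAt (e zero ∸ 1) x
... | inj₁ _ = zero
... | inj₂ y = suc (chainOf t (e ∘ suc) y)

rank : ∀ t e → Fin (size (Q₁ t e)) → ℕ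
rank (suc t) e x with splitAt (e zero ∸ 1) x
... | inj₁ y = toℕ y
... | inj₂ y = rank t (e ∘ suc) y

rank< : ∀ t e x → rank t e x < e (chainOf t e x) ∸ 1
rank< (suc t) e x with splitAt (e zero ∸ 1) x
... | inj₁ y = Finₚ.toℕ<n y
... | inj₂ y = rank< t (e ∘ suc) y

Le-Q₁ : ∀ t e {x y} → Le (Q₁ t e) x y ⇔ (chainOf t e x ≡ chainOf t e y × rank t e x ≤ rank t e y)
Le-Q₁ (suc t) e {x} {y} with splitAt (e zero ∸ 1) x | splitAt (e zero ∸ 1) y
... | inj₁ x′ | inj₁ y′ = mk⇔ (λ h → refl , ≤ᵇ⇒≤ _ _ h) (≤⇒≤ᵇ ∘ proj₂)
... | inj₁ x′ | inj₂ y′ = mk⇔ (λ ()) (λ ())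
... | inj₂ x′ | inj₁ y′ = mk⇔ (λ ()) (λ ())
... | inj₂ x′ | inj₂ y′ = mk⇔
  (λ h → let same , le = to (Le-Q₁ t (e ∘ suc)) h in cong suc same , le)
  (λ (same , le) → from (Le-Q₁ t (e ∘ suc)) (Finₚ.suc-injective same , le))

Q₁-isPreorder : ∀ t e → IsPreorderᵇ (Q₁ t e)
Q₁-isPreorder t e .reflexive  x   = from (Le-Q₁ t e) (refl , ≤-refl)
Q₁-isPreorder t e .transitive p q =
  let same₁ , le₁ = to (Le-Q₁ t e) p ; same₂ , le₂ = to (Le-Q₁ t e) q
  in from (Le-Q₁ t e) (trans same₁ same₂ , ≤-trans le₁ le₂)

element : ∀ t e j → Fin (e j ∸ 1) → Fin (size (Q₁ t e))
element (suc t) e zero    i = i ↑ˡ _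
element (suc t) e (suc j) i = (e zero ∸ 1) ↑ʳ element t (e ∘ suc) j i

chainOf-element : ∀ t e j i → chainOf t e (element t e j i) ≡ j
chainOf-element (suc t) e zero i
  rewrite Finₚ.splitAt-↑ˡ (e zero ∸ 1) i (size (Q₁ t (e ∘ suc))) = refl
chainOf-element (suc t) e (suc j) i
  rewrite Finₚ.splitAt-↑ʳ (e zero ∸ 1) (size (Q₁ t (e ∘ suc))) (element t (e ∘ suc) j i) =
  cong suc (chainOf-element t (e ∘ suc) j i)

rank-element : ∀ t e j i → rank t e (element t e j i) ≡ toℕ i
rank-element (suc t) e zero i
  rewrite Finₚ.splitAt-↑ˡ (e zero ∸ 1) i (size (Q₁ t (e ∘ suc))) = refl
rank-element (suc t) e (suc j) i
  rewrite Finₚ.splitAt-↑ʳ (e zero ∸ 1) (size (Q₁ t (e ∘ suc))) (element t (e ∘ suc) j i) =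
  rank-element t (e ∘ suc) j i

Q-isPreorder : ∀ m t e → IsPreorderᵇ (Q (suc m) t e)
Q-isPreorder zero    t e = Q₁-isPreorder t e
Q-isPreorder (suc m) t e = J-isPreorder (Q (suc m) t e)

-- Labellings of increasing tuples, and the passage between P and J(P).

Increasing : Vec (Fin N) a → Set
Increasing = Linked _<ᶠ_

Linked-init : ∀ {R : A → A → Set} {w : Vec A (suc N)} → Linked R w → Linked R (init w)
Linked-init [-]             = []
Linked-init (r ∷ [-])       = [-]
Linked-init (r ∷ (r′ ∷ rs)) = r ∷ Linked-init (r′ ∷ rs)

-- The index `a` is offset by one, the labelled tuples having `suc a` entries. Irrelevance of the
-- proof makes a label depend on the tuple alone.
record Labelling (N a : ℕ) (P : FinPoset) : Set where
  field
    label : (v : Vec (Fin N) (suc a)) → .(Increasing v) → Fin (size P)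
    shift : ∀ w (w↑ : Increasing w) →
      ¬ Le P (label (tail w) (Linked.tail w↑)) (label (init w) (Linked-init w↑))
open Labelling

module _ {P : FinPoset} (pre : IsPreorderᵇ P) (L : Labelling N (suc a) P) where

  private
    Below : (v : Vec (Fin N) (suc a)) → .(Increasing v) → Fin (size P) → Fin N → Set
    Below v v↑ z x = Σ (x <ᶠ head v) λ q → Le P z (label L (x ∷ v) (q ∷ v↑))

    below? : ∀ v .(v↑ : Increasing v) z → Decidable (Below v v↑ z)
    below? v v↑ z x with x Finₚ.<? head v
    ... | no  x≮v = no (x≮v ∘ proj₁)
    ... | yes x<v = map′ (x<v ,_) proj₂ (T? _)

    generated : (v : Vec (Fin N) (suc a)) → .(Increasing v) → Vec Bool (size P)
    generated v v↑ = tabulate (λ z → ⌊ Finₚ.any? (below? v v↑ z) ⌋)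

    ∈-generated : ∀ v .(v↑ : Increasing v) z → T (lookup (generated v v↑) z) ⇔ ∃ (Below v v↑ z)
    ∈-generated v v↑ z = mk⇔
      (toWitness ∘ subst T (Vecₚ.lookup∘tabulate _ z))
      (subst T (sym (Vecₚ.lookup∘tabulate _ z)) ∘ fromWitness)

    generated-down : ∀ v .(v↑ : Increasing v) → IsDown P (generated v v↑)
    generated-down v v↑ z z′ z≤z′ z′∈ =
      let x , x<v , z′≤ = to (∈-generated v v↑ z′) z′∈
      in from (∈-generated v v↑ z) (x , x<v , transitive pre z≤z′ z′≤)

  -- The label z of w is a generator of the down-set at `tail w`. Were that set contained in the one
  -- at `init w`, some y before w would give z ≤ `label L (y ∷ init w)`, against `shift L` at
  -- `y ∷ w`.
  raise : Labelling N a (J P)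
  raise .label v v↑ = proj₁ (fromDown P (generated v v↑) (generated-down v v↑))
  raise .shift w@(x ∷ v@(_ ∷ _)) w↑@(x<v ∷ v↑) below = shift L (y ∷ w) (y<w ∷ w↑) z≤
    where
    z  = label L w w↑
    i↑ = Linked-init w↑

    z∈tail : T (lookup (generated v v↑) z)
    z∈tail = from (∈-generated v v↑ z) (x , x<v , reflexive pre z)

    z∈init : T (lookup (generated (init w) i↑) z)
    z∈init = subst (λ S → T (lookup S z)) (sym (proj₂ (fromDown P _ (generated-down (init w) i↑))))
      (to (Le-J P _ _) below z
        (subst (λ S → T (lookup S z)) (proj₂ (fromDown P _ (generated-down v v↑))) z∈tail))

    y   = proj₁ (to (∈-generated (init w) i↑ z) z∈init)
    y<w = proj₁ (proj₂ (to (∈-generated (init w) i↑ z) z∈init))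
    z≤  = proj₂ (proj₂ (to (∈-generated (init w) i↑ z) z∈init))

module _ {P : FinPoset} (L : Labelling N a (J P)) where

  private
    Separates : ∀ D E → Fin (size P) → Set
    Separates D E z = _∈ᴶ_ P z D × ¬ _∈ᴶ_ P z E

    separates? : ∀ D E → Dec (∃ (Separates D E))
    separates? D E = Finₚ.any? (λ z → T? _ ×-dec ¬? (T? _))

    separate : ∀ {D E} → ¬ Le (J P) D E → ∃ (Separates D E)
    separate {D} {E} D≰E = decidable-stable (separates? D E) λ none →
      D≰E (from (Le-J P D E) λ z z∈D → decidable-stable (T? _) λ z∉E → none (z , z∈D , z∉E))

    chosen : (w : Vec (Fin N) (suc (suc a))) → .(w↑ : Increasing w) →
      ∃ (Separates (label L (tail w) (Linked.tail w↑)) (label L (init w) (Linked-init w↑)))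
    -- A witness must be computed although `w↑` is irrelevant; deciding its existence by finite
    -- search recovers one.
    chosen w w↑ = recompute (separates? _ _) (separate (shift L w w↑))

  -- With v = `tail w`, the element chosen for `init w` lies in the down-set D at `init v`, whereas
  -- the one chosen for v avoids D. As D is closed downwards, the latter cannot lie below the
  -- former.
  lower : Labelling N (suc a) P
  lower .label w w↑ = proj₁ (chosen w w↑)
  lower .shift w@(_ ∷ v@(_ ∷ _)) w↑@(_ ∷ v↑) z≤y =
    proj₂ (proj₂ (chosen v v↑))
      (∈ᴶ-down P D _ _ z≤y (proj₁ (proj₂ (chosen (init w) (Linked-init w↑)))))
    where D = label L (init v) (Linked-init v↑)

raise* : ∀ b {t e} → Labelling N (a + b) (Q 1 t e) → Labelling N a (Q (suc b) t e)
raise* {N} {a} zero    {t} {e} L = subst (λ a → Labelling N a (Q 1 t e)) (+-identityʳ a) L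
raise* {N} {a} (suc b) {t} {e} L = raise (Q-isPreorder b t e)
  (raise* b (subst (λ a → Labelling N a (Q 1 t e)) (+-suc a b) L))

lower* : ∀ b {t e} → Labelling N a (Q (suc b) t e) → Labelling N (a + b) (Q 1 t e)
lower* {N} {a} zero    {t} {e} L = subst (λ a → Labelling N a (Q 1 t e)) (sym (+-identityʳ a)) L
lower* {N} {a} (suc b) {t} {e} L =
  subst (λ a → Labelling N a (Q 1 t e)) (sym (+-suc a b)) (lower* b (lower L))

-- Equal labels on x < y would contradict `shift` at (x, y) by reflexivity, so distinct vertices get
-- distinct labels.
labelling-size : ∀ {P} → IsPreorderᵇ P → Labelling N 0 P → N ≤ size P
labelling-size {P = P} pre L = ≮⇒≥ λ P<N →
  let x , y , x<y , eq = Finₚ.pigeonhole P<N (λ x → label L (x ∷ []) [-])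
  in shift L (x ∷ y ∷ []) (x<y ∷ [-]) (subst (Le P _) (sym eq) (reflexive pre _))

identityLabelling : ∀ P → Labelling (size (J P)) 0 (J P)
identityLabelling P .label (D ∷ [])     _         = D
identityLabelling P .shift (D ∷ E ∷ []) (D<E ∷ _) = J-linearExtension P D<E

-- Finite search, and vectors as initial segments of sequences.

anyVec? : ∀ n {P : Vec (Fin N) n → Set} → Decidable P → Dec (∃ P)
anyVec? zero    P? = map′ ([] ,_) (λ { ([] , p) → p }) (P? [])
anyVec? (suc n) P? = map′ (λ (x , v , p) → x ∷ v , p) (λ { (x ∷ v , p) → x , v , p })
  (Finₚ.any? (λ x → anyVec? n (λ v → P? (x ∷ v))))

-- Found by scanning downwards from n. The refutation is irrelevant because `longest` derives it
-- from an irrelevant proof of increase.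
lastTrue : ∀ {P : ℕ → Set} → Decidable P → ∀ n → P 0 → .(¬ P n) →
  ∃[ p ] p < n × P p × ¬ P (suc p)
lastTrue P? zero    P0 ¬Pn = ⊥-elim-irr (¬Pn P0)
lastTrue P? (suc n) P0 ¬Pn with P? n
... | yes Pn = n , ≤-refl , Pn , λ Psn → ⊥-elim-irr (¬Pn Psn)
... | no ¬Pn′ = let p , p<n , rest = lastTrue P? n P0 ¬Pn′ in p , m<n⇒m<1+n p<n , rest

prefix : ∀ n → (ℕ → A) → Vec A n
prefix n u = tabulate (u ∘ toℕ)

init-prefix : ∀ n (u : ℕ → A) → init (prefix (suc n) u) ≡ prefix n u
init-prefix zero    u = refl
init-prefix (suc n) u = cong (u 0 ∷_) (init-prefix n (u ∘ suc))

-- Indices beyond the end yield the last entry.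
nth : Vec A (suc N) → ℕ → A
nth (x ∷ [])        _       = x
nth (x ∷ _ ∷ _)     zero    = x
nth (_ ∷ v@(_ ∷ _)) (suc i) = nth v i

prefix-nth : (v : Vec A (suc N)) → prefix (suc N) (nth v) ≡ v
prefix-nth (x ∷ [])        = refl
prefix-nth (x ∷ v@(_ ∷ _)) = cong (x ∷_) (prefix-nth v)

nth-prefix : ∀ n (u : ℕ → A) {i} → i ≤ n → nth (prefix (suc n) u) i ≡ u i
nth-prefix zero    u z≤n       = refl
nth-prefix (suc n) u {zero}  _ = refl
nth-prefix (suc n) u {suc i} (s≤s i≤n) = nth-prefix n (u ∘ suc) i≤n

nth-increasing : {v : Vec (Fin N) (suc a)} → Increasing v → ∀ {i} → i < a → nth v i <ᶠ nth v (suc i)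
nth-increasing {v = _ ∷ _ ∷ []}    (x<y ∷ _)  {zero}  _         = x<y
nth-increasing {v = _ ∷ _ ∷ _ ∷ _} (x<y ∷ _)  {zero}  _         = x<y
nth-increasing {v = _ ∷ _ ∷ _}     (_   ∷ v↑) {suc i} (s≤s i<a) = nth-increasing v↑ i<a

prefix-increasing : ∀ n {u : ℕ → Fin N} → (∀ {i} → suc i < n → u i <ᶠ u (suc i)) → Increasing (prefix n u)
prefix-increasing zero          u↑ = []
prefix-increasing (suc zero)    u↑ = [-]
prefix-increasing (suc (suc n)) u↑ = u↑ (s≤s (s≤s z≤n)) ∷ prefix-increasing (suc n) (u↑ ∘ s≤s)

-- Monochromatic tight paths versus labellings by chains.

infixr 5 _∷ˢ_
_∷ˢ_ : A → (ℕ → A) → ℕ → A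
(x ∷ˢ u) zero    = x
(x ∷ˢ u) (suc i) = u i

-- Only the first edges + a values of vertex matter.
record TightPath {N t : ℕ} (a : ℕ) (c : Vec (Fin N) (suc a) → Fin t) (j : Fin t) (edges : ℕ) :
  Set where
  field
    vertex    : ℕ → Fin N
    ascending : ∀ {i} → suc i < edges + a → vertex i <ᶠ vertex (suc i)
    coloured  : ∀ {r} → r < edges → c (prefix (suc a) (λ i → vertex (r + i))) ≡ j

module _ {N t a} (c : Vec (Fin N) (suc a) → Fin t) where

  -- v is the first edge of a monochromatic tight path with p + 1 edges.
  Starts : ℕ → Vec (Fin N) (suc a) → Set
  Starts zero    v = ⊤
  Starts (suc p) v = ∃[ w ] Increasing w × init w ≡ v × c (tail w) ≡ c v × Starts p (tail w)

  starts? : ∀ p → Decidable (Starts p)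
  starts? zero    v = yes tt
  starts? (suc p) v = anyVec? (suc (suc a)) λ w →
    linked? Finₚ._<?_ w ×-dec Vecₚ.≡-dec Fin._≟_ (init w) v
      ×-dec (c (tail w) Fin.≟ c v) ×-dec starts? p (tail w)

  starts-antimono : ∀ {p q v} → p ≤ q → Starts q v → Starts p v
  starts-antimono z≤n       _                       = tt
  starts-antimono (s≤s p≤q) (w , w↑ , eq , mono , s) = w , w↑ , eq , mono , starts-antimono p≤q s

  -- The equation pins the path to its first edge v, which is what allows the induction to prepend
  -- one more vertex.
  starts-path : ∀ p {v} → Increasing v → Starts p v →
    Σ (TightPath a c (c v) (suc p)) λ π → prefix (suc a) (TightPath.vertex π) ≡ v
  starts-path zero {v} v↑ _ = record
    { vertex    = nth v
    ; ascending = λ { (s≤s i<a) → nth-increasing v↑ i<a }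
    ; coloured  = λ { (s≤s z≤n) → cong c (prefix-nth v) }
    } , prefix-nth v
  starts-path (suc p) {v} v↑ (w@(x ∷ v′@(_ ∷ _)) , w↑ , eq , mono , s)
    with π , πeq ← starts-path p (Linked.tail w↑) s = record
    { vertex    = vertex′
    ; ascending = ascending′
    ; coloured  = coloured′
    } , start
    where
    module π = TightPath π
    vertex′ : ℕ → Fin N
    vertex′ = x ∷ˢ π.vertex

    start : prefix (suc a) vertex′ ≡ v
    start = trans (cong (x ∷_) (trans (sym (init-prefix a π.vertex)) (cong init πeq))) eq

    ascending′ : ∀ {i} → suc i < suc (suc p) + a → vertex′ i <ᶠ vertex′ (suc i)
    ascending′ {zero}  _       = subst (λ v → x <ᶠ head v) (sym πeq) (Linked.head w↑)
    ascending′ {suc i} (s≤s h) = π.ascending h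

    coloured′ : ∀ {r} → r < suc (suc p) → c (prefix (suc a) (λ i → vertex′ (r + i))) ≡ c v
    coloured′ {zero}  _       = cong c start
    coloured′ {suc r} (s≤s h) = trans (π.coloured h) mono

  module _ (e : Fin t → ℕ) (none : ∀ v → Increasing v → ¬ Starts (e (c v) ∸ 1) v) where

    private
      longest : ∀ v → .(v↑ : Increasing v) →
        ∃[ p ] p < e (c v) ∸ 1 × Starts p v × ¬ Starts (suc p) v
      longest v v↑ = lastTrue (λ p → starts? p v) (e (c v) ∸ 1) tt (none v v↑)

      -- A longest path from v has p + 1 edges with p < e - 1. Since p decreases as one moves along
      -- a path, `opposite` reverses it to make labels climb.
      position : ∀ v → .(v↑ : Increasing v) → Fin (e (c v) ∸ 1)
      position v v↑ = opposite (fromℕ< (proj₁ (proj₂ (longest v v↑))))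

      toℕ-position : ∀ v .(v↑ : Increasing v) →
        toℕ (position v v↑) ≡ e (c v) ∸ 1 ∸ suc (proj₁ (longest v v↑))
      toℕ-position v v↑ = trans (Finₚ.opposite-prop _)
        (cong (λ p → e (c v) ∸ 1 ∸ suc p) (Finₚ.toℕ-fromℕ< _))

    -- Edges are labelled by their colour and the number of edges that a monochromatic
    -- tight path starting there falls short of e.
    pathLabelling : Labelling N a (Q₁ t e)
    pathLabelling .label v v↑ = element t e (c v) (position v v↑)
    -- If the label of `tail w` were below that of `init w`, the colours would agree and a longest
    -- path from `tail w` would have at least as many edges as one from `init w`. Prepending
    -- `init w` to it would then beat the maximum at `init w`.
    pathLabelling .shift w w↑ le = proj₂ (proj₂ (proj₂ (longest y y↑)))
      (starts-antimono (s≤s q≤p) (w , w↑ , refl , same , proj₁ (proj₂ (proj₂ (longest x x↑)))))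
      where
      x = tail w ; x↑ = Linked.tail w↑
      y = init w ; y↑ = Linked-init w↑

      same : c x ≡ c y
      same = trans (sym (chainOf-element t e _ _))
        (trans (proj₁ (to (Le-Q₁ t e) le)) (chainOf-element t e _ _))

      rank≤ : e (c y) ∸ 1 ∸ suc (proj₁ (longest x x↑)) ≤ e (c y) ∸ 1 ∸ suc (proj₁ (longest y y↑))
      rank≤ = subst₂ _≤_
        (trans (rank-element t e _ _) (trans (toℕ-position x x↑)
          (cong (λ j → e j ∸ 1 ∸ suc (proj₁ (longest x x↑))) same)))
        (trans (rank-element t e _ _) (toℕ-position y y↑))
        (proj₂ (to (Le-Q₁ t e) le))

      q≤p : proj₁ (longest y y↑) ≤ proj₁ (longest x x↑)
      q≤p = s≤s⁻¹ (∸-cancelʳ-≤ (proj₁ (proj₂ (longest y y↑))) rank≤)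

-- If no edge starts a long enough path, b applications of `raise` to `pathLabelling` label
-- |Q_{b+1}| + 1 single vertices by Q_{b+1}, one vertex too many.
tightPath-exists : ∀ b t e (c : Vec (Fin (suc (size (Q (suc b) t e)))) (suc b) → Fin t) →
  (∀ j → 1 ≤ e j) → ∃[ j ] TightPath b c j (e j)
tightPath-exists b t e c 1≤e
  with anyVec? (suc b) (λ v → linked? Finₚ._<?_ v ×-dec starts? c (e (c v) ∸ 1) v)
... | yes (v , v↑ , s) =
  c v , subst (TightPath b c (c v)) (m+[n∸m]≡n (1≤e (c v))) (proj₁ (starts-path c _ v↑ s))
... | no none = contradiction
  (labelling-size (Q-isPreorder b t e) (raise* b (pathLabelling c e λ v v↑ s → none (v , v↑ , s))))
  1+n≰n

module _ {a t e} (L : Labelling N a (Q₁ t e)) (j₀ : Fin t) where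

  chainColouring : Vec (Fin N) (suc a) → Fin t
  chainColouring v with linked? Finₚ._<?_ v
  ... | yes v↑ = chainOf t e (label L v v↑)
  -- An arbitrary colour for vectors that represent no edge.
  ... | no _   = j₀

  chainColouring-increasing : ∀ v (v↑ : Increasing v) → chainColouring v ≡ chainOf t e (label L v v↑)
  chainColouring-increasing v v↑ with linked? Finₚ._<?_ v
  ... | yes _  = refl
  ... | no ¬v↑ = contradiction v↑ ¬v↑

  private
    label-cong : ∀ {v v′} (eq : v ≡ v′) (v↑ : Increasing v) →
      label L v v↑ ≡ label L v′ (subst Increasing eq v↑)
    label-cong refl v↑ = refl

  -- Along a path in the colour j the labels climb the j-th chain, which has only e j − 1 elements.
  rank-climbs : ∀ {j} n (u : ℕ → Fin N) → (∀ {i} → suc i < suc n + a → u i <ᶠ u (suc i)) →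
    (∀ {r} → r < suc n → chainColouring (prefix (suc a) (λ i → u (r + i))) ≡ j) →
    ∀ (u↑ : Increasing (prefix (suc a) u)) →
    rank t e (label L (prefix (suc a) u) u↑) + n < e j ∸ 1
  rank-climbs {j} zero u asc col u↑ = subst₂ _<_ (sym (+-identityʳ _))
    (cong (λ j → e j ∸ 1) (trans (sym (chainColouring-increasing _ u↑)) (col (s≤s z≤n))))
    (rank< t e _)
  rank-climbs {j} (suc n) u asc col u↑ = begin-strict
    rank t e x + suc n  ≡⟨ +-suc _ n ⟩
    suc (rank t e x) + n ≤⟨ +-monoˡ-≤ n x<y ⟩
    rank t e y + n      <⟨ rank-climbs n (u ∘ suc) (asc ∘ s≤s) (col ∘ s≤s) (Linked.tail w↑) ⟩
    e j ∸ 1             ∎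
    where
    open ≤-Reasoning
    w↑ : Increasing (prefix (suc (suc a)) u)
    w↑ = prefix-increasing (suc (suc a)) (λ i<a → asc (≤-trans i<a (s≤s (s≤s (m≤n+m a n)))))

    x = label L (prefix (suc a) u) u↑
    y = label L (prefix (suc a) (u ∘ suc)) (Linked.tail w↑)

    same : chainOf t e y ≡ chainOf t e x
    same = trans (sym (chainColouring-increasing _ (Linked.tail w↑)))
      (trans (trans (col (s≤s (s≤s z≤n))) (sym (col (s≤s z≤n)))) (chainColouring-increasing _ u↑))

    x<y : rank t e x < rank t e y
    x<y = ≰⇒> λ y≤x → shift L (prefix (suc (suc a)) u) w↑
      (subst (Le (Q₁ t e) y) (sym (label-cong (init-prefix (suc a) u) (Linked-init w↑)))
        (from (Le-Q₁ t e) (same , y≤x)))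

  chainColouring-avoids : ∀ j → 1 ≤ e j → ¬ TightPath a chainColouring j (e j)
  chainColouring-avoids j 1≤e π = n≮n (e j ∸ 1) (≤-<-trans (m≤n+m (e j ∸ 1) _) climbed)
    where
    open TightPath (subst (TightPath a chainColouring j) (sym (m+[n∸m]≡n 1≤e)) π)
    climbed = rank-climbs (e j ∸ 1) vertex ascending coloured
      (prefix-increasing (suc a) λ i<a → ascending (≤-trans i<a (s≤s (m≤n+m a (e j ∸ 1)))))

tightPath-avoidable : ∀ b t e → Fin t → (∀ j → 1 ≤ e j) →
  Σ (Vec (Fin (size (Q (suc (suc b)) t e))) (suc (suc b)) → Fin t) λ c →
    ∀ j → ¬ TightPath (suc b) c j (e j)
tightPath-avoidable b t e j₀ 1≤e =
  chainColouring L j₀ , λ j → chainColouring-avoids L j₀ j (1≤e j)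
  where L = lower* (suc b) (identityLabelling (Q (suc b) t e))

-- Bounded indices, gaps of increasing maps, division by the block length.

clamp : Fin N → ℕ → Fin N
clamp {N} z i with i <? N
... | yes i<N = fromℕ< i<N
... | no _    = z

toℕ-clamp : ∀ (z : Fin N) {i} → i < N → toℕ (clamp z i) ≡ i
toℕ-clamp {N} z {i} i<N with i <? N
... | yes i<N′ = Finₚ.toℕ-fromℕ< i<N′
... | no  i≮N  = contradiction i<N i≮N

ascending⇒mono : ∀ {n} (f : ℕ → ℕ) → (∀ {i} → suc i < n → f i < f (suc i)) →
  ∀ {i j} → i < j → j < n → f i < f j
ascending⇒mono f f↑ {i} {suc j} (s≤s i≤j) j<n with m≤n⇒m<n∨m≡n i≤j
... | inj₂ refl = f↑ j<n
... | inj₁ i<j  = <-trans (ascending⇒mono f f↑ i<j (<-trans (n<1+n j) j<n)) (f↑ j<n)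

-- Each of the i unit steps from x to y raises the value by at least one.
strictlyIncreasing-gap : ∀ {M N} {f : Fin M → Fin N} → StrictlyIncreasing f →
  ∀ i {x y} → toℕ x + i ≡ toℕ y → toℕ (f x) + i ≤ toℕ (f y)
strictlyIncreasing-gap {f = f} f↑ zero    {x} {y} eq
  rewrite Finₚ.toℕ-injective {i = x} {j = y} (trans (sym (+-identityʳ _)) eq) = ≤-reflexive (+-identityʳ _)
strictlyIncreasing-gap {M} {f = f} f↑ (suc i) {x} {y} eq = begin
  toℕ (f x) + suc i   ≡⟨ +-suc _ i ⟩
  suc (toℕ (f x) + i) ≤⟨ s≤s (strictlyIncreasing-gap f↑ i (sym (Finₚ.toℕ-fromℕ< y′<M))) ⟩
  suc (toℕ (f y′))    ≤⟨ f↑ (subst (_< toℕ y) (sym (Finₚ.toℕ-fromℕ< y′<M)) y′<y) ⟩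
  toℕ (f y)           ∎
  where
  open ≤-Reasoning
  y′<y : toℕ x + i < toℕ y
  y′<y = ≤-reflexive (trans (sym (+-suc _ i)) eq)
  y′<M = <-trans y′<y (Finₚ.toℕ<n y)
  y′ = fromℕ< y′<M

module _ (d : ℕ) .{{_ : NonZero d}} where

  [r*d+q]/d : ∀ r q → (r * d + q) / d ≡ r + q / d
  [r*d+q]/d r q = trans (+-distrib-/-∣ˡ q (divides-refl r)) (cong (_+ q / d) (m*n/n≡m r d))

  [r*d+q]%d : ∀ r q → (r * d + q) % d ≡ q % d
  [r*d+q]%d r q = trans (cong (_% d) (+-comm (r * d) q)) ([m+kn]%n≡m%n q r d)

  div-mod : ∀ i → i ≡ i / d * d + i % d
  div-mod i = trans (m≡m%n+[m/n]*n i d) (+-comm (i % d) _)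

map-tabulate-lookup : ∀ {k} {B : Set} (f : A → B) (v : Vec A k) → Vec.map f v ≡ tabulate (f ∘ lookup v)
map-tabulate-lookup f v =
  trans (cong (Vec.map f) (sym (Vecₚ.tabulate∘lookup v))) (sym (Vecₚ.tabulate-∘ f (lookup v)))

-- Reduction of the paths with overlap ℓ to tight paths by blocks of d vertices.

module _ (k ℓ b s : ℕ) .{{_ : NonZero (k ∸ ℓ)}} (s<d : s < k ∸ ℓ)
  (ℓ≡ : ℓ ≡ b * (k ∸ ℓ) + suc s) (k≡ : k ≡ k ∸ ℓ + ℓ) where

  private
    d = k ∸ ℓ

  -- An edge of the path is b + 1 full blocks and s + 1 vertices of another, whence the uniformity b
  -- + 2 of the tight paths.
  k≡′ : k ≡ suc b * d + suc s
  k≡′ = trans k≡ (trans (cong (d +_) ℓ≡) (sym (+-assoc d (b * d) (suc s))))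

  -- The whole path occupies e + b full blocks and part of one more, as many blocks as a tight path
  -- with e edges of size b + 2 has vertices.
  edges-length : ∀ e → e * d + ℓ ≡ (e + b) * d + suc s
  edges-length e = begin
    e * d + ℓ                ≡⟨ cong (e * d +_) ℓ≡ ⟩
    e * d + (b * d + suc s)  ≡⟨ +-assoc (e * d) (b * d) (suc s) ⟨
    e * d + b * d + suc s    ≡⟨ cong (_+ suc s) (*-distribʳ-+ d e b) ⟨
    (e + b) * d + suc s      ∎
    where open ≡-Reasoning

  k≤ : k ≤ suc (suc b) * d
  k≤ = begin
    k                   ≡⟨ k≡′ ⟩
    suc b * d + suc s   ≤⟨ +-monoʳ-≤ (suc b * d) s<d ⟩
    suc b * d + d       ≡⟨ +-comm (suc b * d) d ⟩
    suc (suc b) * d     ∎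
    where open ≤-Reasoning

  module _ {t M : ℕ} where

    -- Each vertex of the tight path is replaced by a block of d vertices, except that the
    -- last block, which may be the truncated block M, contributes only its first s + 1 vertices.
    module _ (z : Fin (M * d + suc s)) where

      spread : (ℕ → Fin (suc M)) → ℕ → ℕ
      spread u i = toℕ (u (i / d)) * d + i % d

      blocks : (ℕ → Fin (suc M)) → ℕ → Fin (M * d + suc s)
      blocks u i = clamp z (spread u i)

      blockColouring : Coloring (M * d + suc s) k t → Vec (Fin (suc M)) (suc (suc b)) → Fin t
      blockColouring c v = c (prefix k (blocks (nth v)))

      module _ (c : Coloring (M * d + suc s) k t) {j e}
        (π : TightPath (suc b) (blockColouring c) j e) where

        open TightPath π

        private
          increasing : ∀ {i i′} → i < i′ → i′ < e + suc b → toℕ (vertex i) < toℕ (vertex i′)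
          increasing = ascending⇒mono (toℕ ∘ vertex) ascending

          quotient≤ : ∀ {i} → i < e * d + ℓ → i / d ≤ e + b
          quotient≤ {i} i< = s≤s⁻¹ (m<n*o⇒m/o<n (begin-strict
            i                   <⟨ i< ⟩
            e * d + ℓ           ≡⟨ edges-length e ⟩
            (e + b) * d + suc s ≤⟨ +-monoʳ-≤ _ s<d ⟩
            (e + b) * d + d     ≡⟨ +-comm _ d ⟩
            suc (e + b) * d     ∎))
            where open ≤-Reasoning

          quotient< : ∀ {i} → i < e * d + ℓ → i / d < e + suc b
          quotient< {i} i< = subst (i / d <_) (sym (+-suc e b)) (s≤s (quotient≤ i<))

          block-mono : ∀ {x y r r′} → x < y → r < d → x * d + r < y * d + r′
          block-mono {x} {y} {r} {r′} x<y r<d = begin-strict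
            x * d + r  <⟨ +-monoʳ-< (x * d) r<d ⟩
            x * d + d  ≡⟨ +-comm (x * d) d ⟩
            suc x * d  ≤⟨ *-monoˡ-≤ d x<y ⟩
            y * d      ≤⟨ m≤m+n _ r′ ⟩
            y * d + r′ ∎
            where open ≤-Reasoning

          -- Before the last block of the path, the image block precedes `vertex (e + b)`, hence
          -- block M, and every residue fits. In the last block the residue is at most s, so even
          -- the truncated block M suffices.
          spread-bounded : ∀ {i} → i < e * d + ℓ → spread vertex i < M * d + suc s
          spread-bounded {i} i< with m≤n⇒m<n∨m≡n (quotient≤ i<)
          ... | inj₁ q< = block-mono
            (<-≤-trans (increasing q< (subst (e + b <_) (sym (+-suc e b)) ≤-refl))
              (s≤s⁻¹ (Finₚ.toℕ<n (vertex (e + b)))))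
            (m%n<n i d)
          ... | inj₂ q≡ = +-mono-≤-< (*-monoˡ-≤ d (s≤s⁻¹ (Finₚ.toℕ<n (vertex (i / d)))))
            (+-cancelˡ-< ((e + b) * d) _ _ (subst₂ _<_
              (trans (div-mod d i) (cong (λ q → q * d + i % d) q≡)) (edges-length e) i<))

          spread-mono : ∀ {i i′} → i < i′ → i′ < e * d + ℓ → spread vertex i < spread vertex i′
          spread-mono {i} {i′} i<i′ i′< with m≤n⇒m<n∨m≡n (/-monoˡ-≤ d (<⇒≤ i<i′))
          ... | inj₁ q<q′ = block-mono (increasing q<q′ (quotient< i′<)) (m%n<n i d)
          ... | inj₂ q≡q′ rewrite q≡q′ = +-monoʳ-< _
            (+-cancelˡ-< (i′ / d * d) _ _ (subst₂ _<_
              (trans (div-mod d i) (cong (λ q → q * d + i % d) q≡q′)) (div-mod d i′) i<i′))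

        tightPath⇒contained : ContainedInColor (Path k ℓ e) c j
        tightPath⇒contained = φ , φ↑ , λ { v (r , r<e , v≡) →
          trans (cong c (trans (map-tabulate-lookup φ v) (Vecₚ.tabulate-cong (same v r v≡)))) (coloured r<e) }
          where
          φ : Fin (e * d + ℓ) → Fin (M * d + suc s)
          φ x = blocks vertex (toℕ x)

          φ↑ : StrictlyIncreasing φ
          φ↑ {x} {y} x<y = subst₂ _<_
            (sym (toℕ-clamp z (spread-bounded (Finₚ.toℕ<n x))))
            (sym (toℕ-clamp z (spread-bounded (Finₚ.toℕ<n y))))
            (spread-mono x<y (Finₚ.toℕ<n y))

          -- Edge r starts at r * d, so it shifts quotients by r and leaves residues unchanged.
          same : ∀ v r → (∀ q → toℕ (lookup v q) ≡ r * d + toℕ q) → ∀ q →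
            φ (lookup v q) ≡ blocks (nth (prefix (suc (suc b)) (λ i → vertex (r + i)))) (toℕ q)
          same v r v≡ q = cong (clamp z) (begin
            spread vertex (toℕ (lookup v q))  ≡⟨ cong (spread vertex) (v≡ q) ⟩
            spread vertex (r * d + toℕ q)
              ≡⟨ cong₂ (λ x y → toℕ (vertex x) * d + y) ([r*d+q]/d d r (toℕ q)) ([r*d+q]%d d r (toℕ q)) ⟩
            toℕ (vertex (r + toℕ q / d)) * d + toℕ q % d
              ≡⟨ cong (λ y → toℕ y * d + toℕ q % d) (nth-prefix (suc b) (λ i → vertex (r + i))
                (s≤s⁻¹ (m<n*o⇒m/o<n (<-≤-trans (Finₚ.toℕ<n q) k≤)))) ⟨
            spread (nth (prefix (suc (suc b)) (λ i → vertex (r + i)))) (toℕ q) ∎)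
            where open ≡-Reasoning

  module _ {t M N : ℕ} (N≤ : N ≤ M * d + s) (z : Fin M) (c : Vec (Fin M) (suc (suc b)) → Fin t) where

    blockOf : Fin N → Fin M
    blockOf x = clamp z (toℕ x / d)

    -- An edge is sampled at its positions 0, d, ..., (b + 1) d; the last one exists because k
    -- exceeds (b + 1) d.
    blockStart : Fin (suc (suc b)) → Fin k
    blockStart i = fromℕ< {toℕ i * d} (begin-strict
      toℕ i * d         ≤⟨ *-monoˡ-≤ d (s≤s⁻¹ (Finₚ.toℕ<n i)) ⟩
      suc b * d         <⟨ m<m+n _ (s≤s z≤n) ⟩
      suc b * d + suc s ≡⟨ k≡′ ⟨
      k                 ∎)
      where open ≤-Reasoning

    sampleColouring : Coloring N k t
    sampleColouring v = c (tabulate (λ i → blockOf (lookup v (blockStart i))))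

    -- Consecutive edges are d apart, so their samples share all but one vertex each: the blocks of
    -- the images of the multiples of d form a tight path.
    contained⇒tightPath : ∀ {j e} → ContainedInColor (Path k ℓ e) sampleColouring j → TightPath (suc b) c j e
    contained⇒tightPath {j} {e} (φ , φ↑ , φ-coloured) = record
      { vertex = λ i → blockOf (φ (at (i * d)))
      ; ascending = asc
      ; coloured = col
      }
      where
      0<ℓ : 0 < ℓ
      0<ℓ = subst (0 <_) (sym ℓ≡) (≤-trans (s≤s z≤n) (m≤n+m (suc s) (b * d)))

      at : ℕ → Fin (e * d + ℓ)
      at = clamp (fromℕ< {0} (≤-trans 0<ℓ (m≤n+m ℓ (e * d))))

      toℕ-at : ∀ {i} → i < e * d + ℓ → toℕ (at i) ≡ i
      toℕ-at = toℕ-clamp _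

      start+s : ∀ {i} → i < e + suc b → i * d + s < e * d + ℓ
      start+s {i} i< = begin-strict
        i * d + s           <⟨ +-mono-≤-< (*-monoˡ-≤ d (s≤s⁻¹ (subst (i <_) (+-suc e b) i<))) (n<1+n s) ⟩
        (e + b) * d + suc s ≡⟨ edges-length e ⟨
        e * d + ℓ           ∎
        where open ≤-Reasoning

      start< : ∀ {i} → i < e + suc b → i * d < e * d + ℓ
      start< i< = ≤-<-trans (m≤m+n _ s) (start+s i<)

      -- The s vertices of the path after the start of a block keep that start below M * d.
      start-bounded : ∀ {i} → i < e + suc b → toℕ (φ (at (i * d))) < M * d
      start-bounded {i} i< = +-cancelʳ-< s _ _ (begin-strict
        toℕ (φ (at (i * d))) + s ≤⟨ strictlyIncreasing-gap φ↑ s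
          (trans (cong (_+ s) (toℕ-at (start< i<))) (sym (toℕ-at (start+s i<)))) ⟩
        toℕ (φ (at (i * d + s))) <⟨ Finₚ.toℕ<n _ ⟩
        N                        ≤⟨ N≤ ⟩
        M * d + s                ∎)
        where open ≤-Reasoning

      toℕ-blockOf : ∀ {i} → i < e + suc b → toℕ (blockOf (φ (at (i * d)))) ≡ toℕ (φ (at (i * d))) / d
      toℕ-blockOf i< = toℕ-clamp z (m<n*o⇒m/o<n (start-bounded i<))

      -- Two consecutive samples have images at least d apart, which forces different blocks.
      asc : ∀ {i} → suc i < e + suc b → blockOf (φ (at (i * d))) <ᶠ blockOf (φ (at (suc i * d)))
      asc {i} si< = begin-strict
        toℕ (blockOf (φ (at (i * d))))      ≡⟨ toℕ-blockOf i< ⟩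
        x / d                               <⟨ n<1+n _ ⟩
        suc (x / d)                         ≡⟨ [r*d+q]/d d 1 x ⟨
        (1 * d + x) / d                     ≤⟨ /-monoˡ-≤ d gap ⟩
        toℕ (φ (at (suc i * d))) / d        ≡⟨ toℕ-blockOf si< ⟨
        toℕ (blockOf (φ (at (suc i * d))))  ∎
        where
        open ≤-Reasoning
        i< = <-trans (n<1+n i) si<
        x  = toℕ (φ (at (i * d)))
        gap : 1 * d + x ≤ toℕ (φ (at (suc i * d)))
        gap = begin
          1 * d + x                ≡⟨ cong (_+ x) (*-identityˡ d) ⟩
          d + x                    ≡⟨ +-comm d x ⟩
          x + d                    ≤⟨ strictlyIncreasing-gap φ↑ d
            (trans (cong (_+ d) (toℕ-at (start< i<)))
              (trans (+-comm (i * d) d) (sym (toℕ-at (start< si<))))) ⟩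
          toℕ (φ (at (suc i * d))) ∎

      col : ∀ {r} → r < e → c (prefix (suc (suc b)) (λ i → blockOf (φ (at ((r + i) * d))))) ≡ j
      col {r} r<e = trans (cong c (Vecₚ.tabulate-cong same)) (φ-coloured v (r , r<e , v≡))
        where
        v : Vec (Fin (e * d + ℓ)) k
        v = tabulate (λ q → at (r * d + toℕ q))

        v≡ : ∀ q → toℕ (lookup v q) ≡ r * d + toℕ q
        v≡ q = trans (cong toℕ (Vecₚ.lookup∘tabulate _ q)) (toℕ-at (begin-strict
          r * d + toℕ q  <⟨ +-monoʳ-< (r * d) (Finₚ.toℕ<n q) ⟩
          r * d + k      ≡⟨ cong (r * d +_) k≡ ⟩
          r * d + (d + ℓ) ≡⟨ +-assoc (r * d) d ℓ ⟨
          r * d + d + ℓ  ≡⟨ cong (_+ ℓ) (+-comm (r * d) d) ⟩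
          suc r * d + ℓ  ≤⟨ +-monoˡ-≤ ℓ (*-monoˡ-≤ d r<e) ⟩
          e * d + ℓ      ∎))
          where open ≤-Reasoning

        same : ∀ i → blockOf (φ (at ((r + toℕ i) * d))) ≡ blockOf (lookup (Vec.map φ v) (blockStart i))
        same i = cong blockOf (sym (begin
          lookup (Vec.map φ v) (blockStart i) ≡⟨ Vecₚ.lookup-map (blockStart i) φ v ⟩
          φ (lookup v (blockStart i))         ≡⟨ cong φ (Vecₚ.lookup∘tabulate _ (blockStart i)) ⟩
          φ (at (r * d + toℕ (blockStart i))) ≡⟨ cong (λ q → φ (at (r * d + q))) (Finₚ.toℕ-fromℕ< _) ⟩
          φ (at (r * d + toℕ i * d))          ≡⟨ cong (φ ∘ at) (*-distribʳ-+ d r (toℕ i)) ⟨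
          φ (at ((r + toℕ i) * d))            ∎))
          where open ≡-Reasoning

-- The arithmetic of i(k,ℓ) and the two bounds on the Ramsey number.

theorem4 : (k ℓ t : ℕ) (e : Fin t → ℕ) → 1 ≤ ℓ → ℓ < k → 1 ≤ t → (∀ j → 1 ≤ e j) →
    (m : ℕ) → IsI k ℓ m →
    IsOrderedRamseyNumber k t (λ j → Path k ℓ (e j))
    ((k ∸ ℓ) * size (Q m t e) + ℓ ∸ (k ∸ ℓ) * (m ∸ 2))
theorem4 k ℓ t e _ _ _ _ (suc zero) (s≤s () , _)
theorem4 k ℓ t e _ ℓ<k 1≤t 1≤e m@(suc (suc b)) (_ , lower-bound , upper-bound) =
  subst (IsOrderedRamseyNumber k t (λ j → Path k ℓ (e j))) (sym value) (ramsey , minimal)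
  where
  d = k ∸ ℓ
  M = size (Q m t e)
  s = ℓ ∸ suc (b * d)

  instance
    d≢0 : NonZero d
    d≢0 = >-nonZero (m<n⇒0<n∸m ℓ<k)

  k≡ : k ≡ d + ℓ
  k≡ = sym (m∸n+n≡m (<⇒≤ ℓ<k))

  -- Substituting k = d + ℓ in b k < ℓ (b + 1) and cancelling b ℓ.
  b*d<ℓ : b * d < ℓ
  b*d<ℓ = +-cancelʳ-< (b * ℓ) _ _ (subst₂ _<_
    (trans (cong (b *_) k≡) (*-distribˡ-+ b d ℓ)) (*-comm ℓ (suc b)) lower-bound)

  ℓ≡ : ℓ ≡ b * d + suc s
  ℓ≡ = trans (sym (m+[n∸m]≡n b*d<ℓ)) (sym (+-suc (b * d) s))

  -- Likewise ℓ (b + 2) ≤ (b + 1) k becomes ℓ ≤ (b + 1) d, which is s + 1 ≤ d.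
  s<d : s < d
  s<d = +-cancelˡ-≤ (b * d) _ _ (subst₂ _≤_ ℓ≡ (+-comm d (b * d))
    (+-cancelʳ-≤ (suc b * ℓ) _ _ (subst₂ _≤_
      (*-comm ℓ m) (trans (cong (suc b *_) k≡) (*-distribˡ-+ (suc b) d ℓ)) upper-bound)))

  value : d * M + ℓ ∸ d * b ≡ M * d + suc s
  value = begin
    d * M + ℓ ∸ d * b               ≡⟨ cong₂ (λ x y → x + y ∸ d * b) (*-comm d M) ℓ≡ ⟩
    M * d + (b * d + suc s) ∸ d * b ≡⟨ cong₂ (λ x y → M * d + (x + suc s) ∸ y) refl (*-comm d b) ⟩
    M * d + (b * d + suc s) ∸ b * d ≡⟨ +-∸-assoc (M * d) (m≤m+n (b * d) (suc s)) ⟩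
    M * d + (b * d + suc s ∸ b * d) ≡⟨ cong (M * d +_) (m+n∸m≡n (b * d) (suc s)) ⟩
    M * d + suc s                   ∎
    where open ≡-Reasoning

  ramsey : RamseyProperty k t (λ j → Path k ℓ (e j)) (M * d + suc s)
  ramsey c =
    let z = fromℕ< {0} (≤-trans (s≤s z≤n) (m≤n+m (suc s) (M * d)))
        j , π = tightPath-exists (suc b) t e (blockColouring k ℓ b s s<d ℓ≡ k≡ z c) 1≤e
    in j , tightPath⇒contained k ℓ b s s<d ℓ≡ k≡ z c π

  minimal : ∀ N → N < M * d + suc s → ¬ RamseyProperty k t (λ j → Path k ℓ (e j)) N
  minimal N N< property =
    let N≤ = s≤s⁻¹ (subst (N <_) (+-suc (M * d) s) N<)
        z = J-nonempty (Q (suc b) t e)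
        c , avoids = tightPath-avoidable b t e (fromℕ< 1≤t) 1≤e
        j , contained = property (sampleColouring k ℓ b s s<d ℓ≡ k≡ N≤ z c)
    in avoids j (contained⇒tightPath k ℓ b s s<d ℓ≡ k≡ N≤ z c contained)
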